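{- Let $t$ be a positive integer and let $G_{t+3}$ be the graph with vertex set $$V(G_{t+3})=\{(i,j): 1\le i<j-1\le t+2,\ (i,j)\ne(1,t+3)\},$$ where $i,j$ are integers, and where two vertices $(i,j)$ and $(k,l)$ are adjacent if and only if they are crossing or separated. Then $\chi(G_{t+3})=t+1$ and the vertex $(2,t+3)$ is critical in $G_{t+3}$.
   Context: The vertices of $G_{t+3}$ are edges of the ordered complete graph on $[t+3]=\{1,\dots,t+3\}$, written as pairs $(i,j)$ with $i<j$. Pairs $(a,b)$ and $(c,d)$ with $a<b$, $c<d$ are crossing if $a<c<b<d$ or $c<a<d<b$; they are separated if $a<b<c<d$ or $c<d<a<b$. (In particular, pairs sharing an element are neither crossing nor separated.) $\chi$ denotes the chromatic number. A vertex of a graph is critical if its removal decreases the chromatic number. -}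

module Defs where

open import Data.Fin.Base using (Fin)
open import Data.Irrelevant using ([_])
open import Data.Nat.Base using (ℕ; suc; _+_; _∸_; _≤_; _<_; NonZero; z≤n; s≤s)
open import Data.Nat.Properties using (<-irrefl; <-trans; m≤n+m; ≤-reflexive; +-suc)
open import Data.Product.Base using (_×_; _,_; ∃; ∃₂)
open import Data.Refinement using (Refinement-syntax; value; _,_)
open import Data.Sum.Base using (_⊎_; inj₁; inj₂; map; swap)
open import Relation.Binary.Definitions using (Symmetric; Irreflexive)
open import Relation.Binary.PropositionalEquality using (_≡_; _≢_; refl; cong)
open import Relation.Nullary.Negation.Core using (¬_)

record Graph : Set₁ where
  field
    V          : Set
    Adj        : V → V → Set
    adj-sym    : Symmetric Adj
    adj-irrefl : Irreflexive _≡_ Adj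

open Graph public

-- The refinement type carries its proof irrelevantly, so each remaining vertex
-- is represented exactly once.
_-_ : (G : Graph) → V G → Graph
G - v = record
  { V          = [ u ∈ V G ∣ u ≢ v ]
  ; Adj        = λ x y → Adj G (value x) (value y)
  ; adj-sym    = adj-sym G
  ; adj-irrefl = λ x≡y → adj-irrefl G (cong value x≡y)
  }

Colorable : Graph → ℕ → Set
Colorable G k = ∃ λ (c : V G → Fin k) → ∀ x y → Adj G x y → c x ≢ c y

-- χ is a relation: for an arbitrary graph the least k exists only classically.
χ[_]=_ : Graph → ℕ → Set
χ[ G ]= k = Colorable G k × (∀ m → Colorable G m → k ≤ m)

Critical : (G : Graph) → V G → Set
Critical G v = ∃₂ λ k m → χ[ G ]= k × χ[ G - v ]= m × m < k

Crossing : ℕ × ℕ → ℕ × ℕ → Set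
Crossing (a , b) (c , d) = (a < c × c < b × b < d) ⊎ (c < a × a < d × d < b)

Separated : ℕ × ℕ → ℕ × ℕ → Set
Separated (a , b) (c , d) = (a < b × b < c × c < d) ⊎ (c < d × d < a × a < b)

-- Truncated subtraction is harmless: i < j ∸ 1 forces j ≥ 2.
IsVertex : ℕ → ℕ × ℕ → Set
IsVertex t (i , j) =
  1 ≤ i × i < j ∸ 1 × j ∸ 1 ≤ t + 2 × (i , j) ≢ (1 , t + 3)

-- The vertices are bare pairs: their membership proofs are irrelevant, so two
-- vertices are propositionally equal as soon as their endpoints agree.
Vertex : ℕ → Set
Vertex t = [ p ∈ ℕ × ℕ ∣ IsVertex t p ]

CrossingOrSeparated : ℕ × ℕ → ℕ × ℕ → Set
CrossingOrSeparated p q = Crossing p q ⊎ Separated p q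

crossingOrSeparated-sym : Symmetric CrossingOrSeparated
crossingOrSeparated-sym = map swap swap

crossingOrSeparated-irrefl : ∀ p → ¬ CrossingOrSeparated p p
crossingOrSeparated-irrefl p (inj₁ (inj₁ (a<a , _))) = <-irrefl refl a<a
crossingOrSeparated-irrefl p (inj₁ (inj₂ (a<a , _))) = <-irrefl refl a<a
crossingOrSeparated-irrefl p (inj₂ (inj₁ (a<b , b<a , _))) = <-irrefl refl (<-trans a<b b<a)
crossingOrSeparated-irrefl p (inj₂ (inj₂ (a<b , b<a , _))) = <-irrefl refl (<-trans a<b b<a)

-- G[ t +3] is the graph G_{t+3}.
G[_+3] : ℕ → Graph
G[ t +3] = record
  { V          = Vertex t
  ; Adj        = λ x y → CrossingOrSeparated (value x) (value y)
  ; adj-sym    = crossingOrSeparated-sym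
  ; adj-irrefl = λ { {x} refl → crossingOrSeparated-irrefl (value x) }
  }

isVertex-2-t+3 : ∀ t .{{_ : NonZero t}} → IsVertex t (2 , t + 3)
isVertex-2-t+3 (suc s) = s≤s z≤n , m≤n+m 3 s , ≤-reflexive (+-suc s 2) , λ ()

⟨2,_+3⟩ : ∀ t .{{_ : NonZero t}} → V G[ t +3]
⟨2, t +3⟩ = (2 , t + 3) , [ isVertex-2-t+3 t ]

{-# OPTIONS --safe #-}

-- For the lower bound, G_{n-1} together with the apex (n-2 , n) spans a Mycielskian
-- inside G_n: there are maps f₀ = shift₀ and f₁ = shift₁ from G_{n-1} to G_n such that
-- v ~ w implies f₀ v ~ f₀ w and f₁ v ~ f₀ w, and every f₁ v is adjacent to the apex.
-- Here f₀ skips the point n-1 of [n], and f₁ moves the right endpoints n-2 and n-1 to n-1.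
-- As in Mycielski's theorem, recolouring each v for which f₀ v has the colour of the apex
-- by the colour of f₁ v saves one colour.
--
-- For the upper bounds, colour (i , j) by i; after the removal of (2 , n) the pairs (1 , j)
-- with j ≤ n-2 can join the colour j, and (1 , n-1) shares one colour with all the (2 , j).
module Submission where

open import Data.Fin.Base using (Fin; zero; suc; fromℕ<; punchOut)
open import Data.Fin.Properties using (fromℕ<-injective; punchOut-injective; suc-injective)
  renaming (_≟_ to _≟ᶠ_)
open import Data.Irrelevant using ([_])
open import Data.Nat.Base
  using (ℕ; zero; suc; _+_; _∸_; _≤_; _<_; NonZero; z≤n; s≤s; s≤s⁻¹)
open import Data.Nat.Properties hiding (suc-injective)
open import Data.Product.Base using (_×_; _,_; proj₁; proj₂)
open import Data.Product.Properties using (≡-dec)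
open import Data.Refinement using (value; value-injective; _,_) renaming (_≟_ to ≟-refinement)
open import Data.Sum.Base using (_⊎_; inj₁; inj₂)
open import Relation.Binary.Definitions using (tri<; tri≈; tri>)
open import Relation.Binary.PropositionalEquality
open import Relation.Nullary using (Dec; yes; no; contradiction; ¬?; _×-dec_)
open import Relation.Nullary.Decidable.Core using (recompute)
open import Relation.Nullary.Recomputable using (¬-recompute)
open import Defs

-- Recolouring and vertex removal in arbitrary graphs.

mycielski-colorable : ∀ {G H k} (f₀ f₁ : V H → V G) (apex : V G) →
  (∀ v → Adj G (f₁ v) apex) →
  (∀ v w → Adj H v w → Adj G (f₀ v) (f₀ w)) →
  (∀ v w → Adj H v w → Adj G (f₁ v) (f₀ w)) →
  Colorable G (suc k) → Colorable H k
mycielski-colorable {G} {H} f₀ f₁ apex f₁~apex f₀~f₀ f₁~f₀ (c , proper) =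
  (λ v → punchOut (apex≢recolour v)) ,
  λ v w v~w e → recolour-proper v w v~w
    (punchOut-injective (apex≢recolour v) (apex≢recolour w) e)
  where
  recolour : V H → Fin _
  recolour v with c apex ≟ᶠ c (f₀ v)
  ... | yes _ = c (f₁ v)
  ... | no  _ = c (f₀ v)

  apex≢recolour : ∀ v → c apex ≢ recolour v
  apex≢recolour v with c apex ≟ᶠ c (f₀ v)
  ... | yes _  = ≢-sym (proper _ _ (f₁~apex v))
  ... | no  ne = ne

  recolour-proper : ∀ v w → Adj H v w → recolour v ≢ recolour w
  recolour-proper v w v~w with c apex ≟ᶠ c (f₀ v) | c apex ≟ᶠ c (f₀ w)
  -- Adjacent vertices are never both recoloured: `f₀ v` and `f₀ w` would share the colour of the
  -- apex.
  ... | yes p | yes q = contradiction (trans (sym p) q) (proper _ _ (f₀~f₀ v w v~w))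
  ... | yes _ | no  _ = proper _ _ (f₁~f₀ v w v~w)
  ... | no  _ | yes _ = ≢-sym (proper _ _ (f₁~f₀ w v (adj-sym H v~w)))
  ... | no  _ | no  _ = proper _ _ (f₀~f₀ v w v~w)

-- `v` gets a fresh colour. This carries a lower bound for `G` over to `G - v`, whose exact
-- chromatic number `Critical` asks for.
colorable-from-removal : ∀ {G k} (v : V G) → (∀ u → Dec (u ≡ v)) →
  Colorable (G - v) k → Colorable G (suc k)
colorable-from-removal {G} {k} v _≟v (c , proper) = c′ , proper′
  where
  c′ : V G → Fin (suc k)
  c′ u with u ≟v
  ... | yes _   = zero
  ... | no  u≢v = suc (c (u , [ u≢v ]))

  proper′ : ∀ x y → Adj G x y → c′ x ≢ c′ y
  proper′ x y x~y e with x ≟v | y ≟v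
  ... | yes refl | yes refl = adj-irrefl G refl x~y
  ... | no x≢v   | no y≢v   = proper (x , [ x≢v ]) (y , [ y≢v ]) x~y (suc-injective e)

-- Adjacency and membership in workable form.

infix 4 _≺_

-- Adjacency oriented by left endpoint: for increasing pairs, `c < b` means crossing and `b < c`
-- separated, so only the shared endpoint `b ≡ c` has to be excluded.
_≺_ : ℕ × ℕ → ℕ × ℕ → Set
(a , b) ≺ (c , d) = a < c × b < d × b ≢ c

adj⇒≺ : ∀ p q → CrossingOrSeparated p q → p ≺ q ⊎ q ≺ p
adj⇒≺ _ _ (inj₁ (inj₁ (a<c , c<b , b<d))) = inj₁ (a<c , b<d , >⇒≢ c<b)
adj⇒≺ _ _ (inj₁ (inj₂ (c<a , a<d , d<b))) = inj₂ (c<a , d<b , >⇒≢ a<d)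
adj⇒≺ _ _ (inj₂ (inj₁ (a<b , b<c , c<d))) =
  inj₁ (<-trans a<b b<c , <-trans b<c c<d , <⇒≢ b<c)
adj⇒≺ _ _ (inj₂ (inj₂ (c<d , d<a , a<b))) =
  inj₂ (<-trans c<d d<a , <-trans d<a a<b , <⇒≢ d<a)

≺⇒adj : ∀ {a b c d} → a < b → c < d → (a , b) ≺ (c , d) →
  CrossingOrSeparated (a , b) (c , d)
≺⇒adj {b = b} {c} a<b c<d (a<c , b<d , b≢c) with <-cmp b c
... | tri< b<c _ _ = inj₂ (inj₁ (a<b , b<c , c<d))
... | tri≈ _ b≡c _ = contradiction b≡c b≢c
... | tri> _ _ c<b = inj₁ (inj₁ (a<c , c<b , b<d))

-- Decidability lets `isVertex` recover a relevant proof from the irrelevant one.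
isVertex? : ∀ t p → Dec (IsVertex t p)
isVertex? t (i , j) =
  1 ≤? i ×-dec i <? j ∸ 1 ×-dec j ∸ 1 ≤? t + 2 ×-dec ¬? (≡-dec _≟_ _≟_ (i , j) (1 , t + 3))

isVertex : ∀ t (v : Vertex t) → IsVertex t (value v)
isVertex t (p , [ p-ok ]) = recompute (isVertex? t p) p-ok

-- Without truncated subtraction and with the constants in front, the bounds compute and `s≤s` can
-- be peeled off.
IsVertex′ : ℕ → ℕ × ℕ → Set
IsVertex′ t (i , j) = 1 ≤ i × 2 + i ≤ j × j ≤ 3 + t × (i ≡ 1 → j ≢ 3 + t)

isVertex⇒′ : ∀ {t i j} → IsVertex t (i , j) → IsVertex′ t (i , j)
isVertex⇒′ {t} {i} {suc j} (1≤i , i<j , j≤t+2 , ≢1n) =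
  1≤i , s≤s i<j , s≤s (subst (j ≤_) (+-comm t 2) j≤t+2) ,
  λ i≡1 j≡3+t → ≢1n (cong₂ _,_ i≡1 (trans j≡3+t (+-comm 3 t)))

isVertex′⇒ : ∀ {t i j} → IsVertex′ t (i , j) → IsVertex t (i , j)
isVertex′⇒ {t} {i} {suc j} (1≤i , s≤s i<j , s≤s j≤2+t , ≢1n) =
  1≤i , i<j , subst (j ≤_) (+-comm 2 t) j≤2+t ,
  λ e → ≢1n (cong proj₁ e) (trans (cong proj₂ e) (+-comm t 3))

isVertex′ : ∀ t (v : Vertex t) → IsVertex′ t (value v)
isVertex′ t v = isVertex⇒′ (isVertex t v)

vertex : ∀ {t i j} → IsVertex′ t (i , j) → Vertex t
vertex v = _ , [ isVertex′⇒ v ]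

endpoints-< : ∀ t (v : Vertex t) → proj₁ (value v) < proj₂ (value v)
endpoints-< t v = let _ , 2+i≤j , _ = isVertex′ t v in <-trans (n<1+n _) 2+i≤j

≺⇒Adj : ∀ t (v w : Vertex t) → value v ≺ value w → Adj G[ t +3] v w
≺⇒Adj t v w = ≺⇒adj (endpoints-< t v) (endpoints-< t w)

-- Keeping `end` abstract makes the criterion apply both to the graph and to the graph with a vertex
-- removed.
ℕ-colorable : ∀ G (end : V G → ℕ × ℕ) →
  (∀ {x y} → Adj G x y → CrossingOrSeparated (end x) (end y)) →
  ∀ {k} (c : V G → ℕ) → (∀ x → c x < k) →
  (∀ x y → end x ≺ end y → c x ≢ c y) → Colorable G k
ℕ-colorable G end adj⇒ c c<k proper =
  (λ x → fromℕ< (c<k x)) , λ x y x~y e →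
    ≢-of-≺ x y (adj⇒≺ _ _ (adj⇒ x~y)) (fromℕ<-injective _ _ (c<k x) (c<k y) e)
  where
  ≢-of-≺ : ∀ x y → end x ≺ end y ⊎ end y ≺ end x → c x ≢ c y
  ≢-of-≺ x y (inj₁ x≺y) e = proper x y x≺y e
  ≢-of-≺ x y (inj₂ y≺x) e = proper y x y≺x (sym e)

-- The two maps on right endpoints, from `G_{n-1}` to `G_n` with `n = 4 + t`.

stretch₀ stretch₁ : ℕ → ℕ → ℕ
stretch₀ t j with j ≤? 2 + t
... | yes _ = j
... | no  _ = 4 + t
stretch₁ t j with j ≤? 1 + t
... | yes _ = j
... | no  _ = 3 + t

stretch₀-fixes : ∀ {t j} → j < 3 + t → stretch₀ t j ≡ j
stretch₀-fixes {t} {j} j<3+t with j ≤? 2 + t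
... | yes _ = refl
... | no ≰  = contradiction (s≤s⁻¹ j<3+t) ≰

stretch₀-≥ : ∀ {t j} → j ≤ 3 + t → j ≤ stretch₀ t j
stretch₀-≥ {t} {j} j≤3+t with j ≤? 2 + t
... | yes _ = ≤-refl
... | no  _ = m≤n⇒m≤1+n j≤3+t

stretch₁-≥ : ∀ {t j} → j ≤ 3 + t → j ≤ stretch₁ t j
stretch₁-≥ {t} {j} j≤3+t with j ≤? 1 + t
... | yes _ = ≤-refl
... | no  _ = j≤3+t

stretch₁-≤ : ∀ t j → stretch₁ t j ≤ 3 + t
stretch₁-≤ t j with j ≤? 1 + t
... | yes j≤1+t = m≤n⇒m≤1+n (m≤n⇒m≤1+n j≤1+t)
... | no  _     = ≤-refl

-- `2 + t` is the left endpoint of the apex, so hitting it would destroy adjacency.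
stretch₁-≢2+t : ∀ t j → stretch₁ t j ≢ 2 + t
stretch₁-≢2+t t j with j ≤? 1 + t
... | yes j≤1+t = <⇒≢ (s≤s j≤1+t)
... | no  _     = >⇒≢ (n<1+n _)

stretch₁<stretch₀ : ∀ {t b d} → b < d → d ≤ 3 + t → stretch₁ t b < stretch₀ t d
stretch₁<stretch₀ {t} {b} {d} b<d d≤3+t with b ≤? 1 + t | d ≤? 2 + t
... | yes _     | yes _     = b<d
... | yes b≤1+t | no  _     = <-trans (s≤s b≤1+t) (n≤1+n _)
... | no b≰1+t  | yes d≤2+t = contradiction (s≤s⁻¹ (≤-trans b<d d≤2+t)) b≰1+t
-- Here `b = 2 + t` and `d = 3 + t`, and both move up by one.
... | no _      | no _      = ≤-refl

-- A right endpoint is moved only to `3 + t`, which lies beyond every left endpoint of the smaller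
-- graph.
stretch₁-≢ : ∀ {t b c} → c < 3 + t → b ≢ c → stretch₁ t b ≢ c
stretch₁-≢ {t} {b} c<3+t b≢c with b ≤? 1 + t
... | yes _ = b≢c
... | no  _ = >⇒≢ c<3+t

shift₀ shift₁ : ∀ {t} → Vertex t → Vertex (suc t)
shift₀ {t} v@((i , j) , _) = vertex (1≤i , ≤-trans 2+i≤j (stretch₀-≥ j≤3+t) , bound , ≢1n′)
  where
  1≤i   = proj₁ (isVertex′ t v)
  2+i≤j = proj₁ (proj₂ (isVertex′ t v))
  j≤3+t = proj₁ (proj₂ (proj₂ (isVertex′ t v)))
  ≢1n   = proj₂ (proj₂ (proj₂ (isVertex′ t v)))

  bound : stretch₀ t j ≤ 4 + t
  bound with j ≤? 2 + t
  ... | yes j≤2+t = m≤n⇒m≤1+n (m≤n⇒m≤1+n j≤2+t)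
  ... | no  _     = ≤-refl

  -- The smaller graph lacks `(1 , 3 + t)`, the only pair that `stretch₀` would send to the excluded
  -- `(1 , 4 + t)`.
  ≢1n′ : i ≡ 1 → stretch₀ t j ≢ 4 + t
  ≢1n′ i≡1 e = <⇒≢ (s≤s j≤3+t) (trans (sym (stretch₀-fixes (≤∧≢⇒< j≤3+t (≢1n i≡1)))) e)
shift₁ {t} v@((i , j) , _) =
  let 1≤i , 2+i≤j , j≤3+t , _ = isVertex′ t v in
  vertex (1≤i , ≤-trans 2+i≤j (stretch₁-≥ j≤3+t) , m≤n⇒m≤1+n (stretch₁-≤ t j) ,
          λ _ → <⇒≢ (s≤s (stretch₁-≤ t j)))

apex : ∀ t → Vertex (suc t)
apex t = vertex {i = 2 + t} (s≤s z≤n , ≤-refl , ≤-refl , λ ())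

≤3+t : ∀ t (v : Vertex t) → proj₂ (value v) ≤ 3 + t
≤3+t t v = proj₁ (proj₂ (proj₂ (isVertex′ t v)))

shift₁~apex : ∀ t (v : Vertex t) → Adj G[ suc t +3] (shift₁ v) (apex t)
shift₁~apex t v@((i , j) , _) =
  let _ , 2+i≤j , j≤3+t , _ = isVertex′ t v in
  ≺⇒Adj (suc t) (shift₁ v) (apex t)
    (s≤s⁻¹ (≤-trans 2+i≤j j≤3+t) , s≤s (stretch₁-≤ t j) , stretch₁-≢2+t t j)

-- From `b < d ≤ 3 + t` it follows that `b` is fixed, so it still avoids `c`, while `d` can only
-- move up.
shift₀-≺ : ∀ t (v w : Vertex t) → value v ≺ value w → value (shift₀ v) ≺ value (shift₀ w)
shift₀-≺ t v@((a , b) , _) w@((c , d) , _) (a<c , b<d , b≢c)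
  rewrite stretch₀-fixes (≤-trans b<d (≤3+t t w)) =
  a<c , ≤-trans b<d (stretch₀-≥ (≤3+t t w)) , b≢c

shift₁-≺-shift₀ : ∀ t (v w : Vertex t) → value v ≺ value w →
  value (shift₁ v) ≺ value (shift₀ w)
shift₁-≺-shift₀ t v w (a<c , b<d , b≢c) =
  a<c , stretch₁<stretch₀ b<d (≤3+t t w) ,
  stretch₁-≢ (≤-trans (endpoints-< t w) (≤3+t t w)) b≢c

-- The two shifts play different roles, so a mixed edge needs both orientations of `_≺_`.
shift₀-≺-shift₁ : ∀ t (v w : Vertex t) → value v ≺ value w →
  value (shift₀ v) ≺ value (shift₁ w)
shift₀-≺-shift₁ t v@((a , b) , _) w (a<c , b<d , b≢c)
  rewrite stretch₀-fixes (≤-trans b<d (≤3+t t w)) =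
  a<c , ≤-trans b<d (stretch₁-≥ (≤3+t t w)) , b≢c

shift₀~shift₀ : ∀ t (v w : Vertex t) → Adj G[ t +3] v w →
  Adj G[ suc t +3] (shift₀ v) (shift₀ w)
shift₀~shift₀ t v w v~w with adj⇒≺ _ _ v~w
... | inj₁ v≺w = ≺⇒Adj (suc t) (shift₀ v) (shift₀ w) (shift₀-≺ t v w v≺w)
... | inj₂ w≺v = crossingOrSeparated-sym (≺⇒Adj (suc t) (shift₀ w) (shift₀ v) (shift₀-≺ t w v w≺v))

shift₁~shift₀ : ∀ t (v w : Vertex t) → Adj G[ t +3] v w →
  Adj G[ suc t +3] (shift₁ v) (shift₀ w)
shift₁~shift₀ t v w v~w with adj⇒≺ _ _ v~w
... | inj₁ v≺w = ≺⇒Adj (suc t) (shift₁ v) (shift₀ w) (shift₁-≺-shift₀ t v w v≺w)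
... | inj₂ w≺v =
  crossingOrSeparated-sym (≺⇒Adj (suc t) (shift₀ w) (shift₁ v) (shift₀-≺-shift₁ t w v w≺v))

-- The lower bound, losing one point and one colour at each induction step.

lower-bound : ∀ s m → Colorable G[ suc s +3] m → 2 + s ≤ m
lower-bound s zero (c , _) with () ← c (apex s)
-- The base graph has an edge: `(1 , 3)` crosses `(2 , 4)`.
lower-bound zero (suc zero) (c , proper) =
  contradiction (Fin1-unique (c v₁₃) (c v₂₄))
    (proper v₁₃ v₂₄ (inj₁ (inj₁ (≤-refl , ≤-refl , ≤-refl))))
  where
  v₁₃ v₂₄ : Vertex 1
  v₁₃ = vertex (≤-refl , ≤-refl , n≤1+n 3 , λ _ ())
  v₂₄ = apex 0
  Fin1-unique : (i j : Fin 1) → i ≡ j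
  Fin1-unique zero zero = refl
lower-bound zero (suc (suc m)) _ = s≤s (s≤s z≤n)
lower-bound (suc s) (suc m) col = s≤s (lower-bound s m
  (mycielski-colorable {G = G[ 2 + s +3]} {H = G[ suc s +3]} (shift₀ {t}) (shift₁ {t}) (apex t)
    (shift₁~apex t) (shift₀~shift₀ t) (shift₁~shift₀ t) col))
  where t = suc s

-- Upper bounds from explicit colourings.

colorable : ∀ s → Colorable G[ suc s +3] (2 + s)
colorable s =
  ℕ-colorable G[ suc s +3] value (λ adj → adj) (λ v → proj₁ (value v) ∸ 1) bound proper
  where
  bound : ∀ v → proj₁ (value v) ∸ 1 < 2 + s
  bound v@((suc i , j) , _) =
    let _ , 2+i≤j , j≤3+t , _ = isVertex′ (suc s) v in s≤s⁻¹ (s≤s⁻¹ (≤-trans 2+i≤j j≤3+t))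
  bound v@((zero , j) , _) = s≤s z≤n
  proper : ∀ (v w : Vertex (suc s)) → value v ≺ value w →
    proj₁ (value v) ∸ 1 ≢ proj₁ (value w) ∸ 1
  proper v w (a<c , _) = <⇒≢ (∸-monoˡ-< a<c (proj₁ (isVertex′ (suc s) v)))

-- Away from (2 , 4 + s): the colour 0 consists of (1 , 3 + s) and the pairs (2 , j) nested in
-- it, and all pairs of a colour k ≥ 1 contain k + 2.
κ : ℕ → ℕ × ℕ → ℕ
κ s (1 , j) with j ≤? 2 + s
... | yes _ = j ∸ 2
... | no  _ = 0
κ s (i , j) = i ∸ 2

κ-bound : ∀ s (v : Vertex (suc s)) → κ s (value v) < suc s
κ-bound s ((0 , j) , _) = s≤s z≤n
κ-bound s ((1 , j) , _) with j ≤? 2 + s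
... | yes j≤2+s = s≤s (∸-monoˡ-≤ 2 j≤2+s)
... | no  _     = s≤s z≤n
κ-bound s ((2 , j) , _) = s≤s z≤n
κ-bound s v@((suc (suc (suc i)) , j) , _) =
  let _ , 2+i≤j , j≤3+t , _ = isVertex′ (suc s) v in s≤s⁻¹ (s≤s⁻¹ (s≤s⁻¹ (≤-trans 2+i≤j j≤3+t)))

κ-proper : ∀ s (v w : Vertex (suc s)) → value w ≢ (2 , 4 + s) →
  value v ≺ value w → κ s (value v) ≢ κ s (value w)
κ-proper s v@((0 , _) , _) _ _ _ = contradiction (proj₁ (isVertex′ (suc s) v)) λ ()
κ-proper s ((suc _ , _) , _) ((0 , _) , _) _ (() , _)
κ-proper s ((suc _ , _) , _) ((1 , _) , _) _ (s≤s () , _)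
κ-proper s v@((1 , b) , _) w@((2 , d) , _) w≢ (_ , b<d , _) e with b ≤? 2 + s
... | yes _ = >⇒≢ (m<n⇒0<n∸m (proj₁ (proj₂ (isVertex′ (suc s) v)))) e
-- Now `b ≥ 3 + s`, so `b < d ≤ 4 + s` forces `w` to be the removed vertex.
... | no b≰ = w≢ (cong (2 ,_) (≤-antisym (≤3+t (suc s) w) (≤-trans (s≤s (≰⇒> b≰)) b<d)))
κ-proper s v@((1 , b) , _) ((suc (suc (suc c)) , d) , _) _ (_ , _ , b≢c) e with b ≤? 2 + s
-- Equal colours would give `b ≡ 3 + c`, a shared endpoint; cancelling the truncated `∸ 2` is sound
-- as `b ≥ 2`.
... | yes _ = b≢c (∸-cancelʳ-≡ (<⇒≤ (proj₁ (proj₂ (isVertex′ (suc s) v)))) (s≤s (s≤s z≤n)) e)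
κ-proper s ((suc (suc a) , b) , _) ((suc (suc c) , d) , _) _ (s≤s (s≤s a<c) , _) e =
  <⇒≢ a<c e

lemma3p7 : (t : ℕ) .{{_ : NonZero t}} →
    χ[ G[ t +3] ]= (t + 1) × Critical G[ t +3] ⟨2, t +3⟩
lemma3p7 t@(suc s) =
  subst (χ[ G[ t +3] ]=_) (cong suc (+-comm 1 s)) χ≡2+s ,
  2 + s , 1 + s , χ≡2+s , (removal-colorable , removal-lower-bound) , ≤-refl
  where
  χ≡2+s : χ[ G[ t +3] ]= (2 + s)
  χ≡2+s = colorable s , lower-bound s

  removal : Graph
  removal = G[ t +3] - ⟨2, t +3⟩

  ≢2n : (u : V removal) → value (value u) ≢ (2 , 4 + s)
  -- Equal pairs are equal vertices, and a negation can be recomputed from its irrelevant proof.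
  ≢2n (u , [ u≢ ]) e = ¬-recompute u≢
    (value-injective (trans e (cong (λ n → 2 , suc n) (+-comm 3 s))))

  removal-colorable : Colorable removal (1 + s)
  removal-colorable = ℕ-colorable removal (λ u → value (value u)) (λ adj → adj)
    (λ u → κ s (value (value u))) (λ u → κ-bound s (value u))
    (λ u w → κ-proper s (value u) (value w) (≢2n w))

  removal-lower-bound : ∀ m → Colorable removal m → 1 + s ≤ m
  removal-lower-bound m col = s≤s⁻¹ (lower-bound s (suc m)
    (colorable-from-removal {G = G[ t +3]} ⟨2, t +3⟩
      (λ u → ≟-refinement (≡-dec _≟_ _≟_) u ⟨2, t +3⟩) col))
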